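{- Let $\alpha_i\ge 0$, $\beta_i>0$ ($1\le i\le 5$) and $Q>0$ be real numbers, and consider the networks $N$ and $N^+$ with these parameters and total flow $Q$. Suppose that at equilibria both $N$ and $N^+$ have no paths with vanishing flow. Then Braess' paradox occurs in $N/N^+$ (i.e. $T^+_{Eq}>T_{Eq}$) if and only if $\mathcal B_1>0$ and $$\max\left\{\frac{\alpha}{\beta_{12}},\ \frac{ -\alpha}{\beta_{45}},\ \mu_1,\ \mu_2\right\} < Q < \frac{\hat\alpha\beta_{14}+\bar\alpha\beta_{25}}{\mathcal B_1}.$$
   Context: The network $N^+$ has nodes $a,b,c,d$ and directed links $(a,b),(b,d),(b,c),(a,c),(c,d)$ with travel times $\alpha_1+\beta_1f_{ab}$, $\alpha_2+\beta_2f_{bd}$, $\alpha_3+\beta_3f_{bc}$, $\alpha_4+\beta_4f_{ac}$, $\alpha_5+\beta_5f_{cd}$ respectively, where $f_{ij}\ge 0$ is the (real) flow on link $(i,j)$ and $\alpha_i\ge 0$, $\beta_i>0$. All traffic, of total amount $Q>0$ (real), goes from $a$ to $d$ along the paths $P_1=a-b-d$, $P_2=a-c-d$, $P_3=a-b-c-d$. The network $N$ is $N^+$ with the link $(b,c)$ removed, so its paths are $P_1,P_2$ only. A flow assigns a non-negative real amount to each path, with total $Q$; the flow on a link is the sum of the flows of the paths containing it; the travel time on a path is the sum of the travel times of its links. A path has vanishing flow if its path flow is $0$, and non-vanishing flow otherwise. A network is at equilibrium if all paths with non-vanishing flow have the same travel time, and every path with vanishing flow has travel time at least this common value. The equilibrium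 exists and is unique; its common travel time is denoted $T_{Eq}$ for $N$ and $T^+_{Eq}$ for $N^+$. Braess' paradox is said to occur in $N/N^+$ for the total flow $Q$ if $T^+_{Eq}>T_{Eq}$. Notation: multiple indices denote sums, e.g. $\alpha_{ij}=\alpha_i+\alpha_j$, $\beta_{ij}=\beta_i+\beta_j$. Further, $\alpha=\alpha_{45}-\alpha_{12}$, $\bar\alpha=\alpha_4-\alpha_{13}$, $\hat\alpha=\alpha_2-\alpha_{35}$, $\mathcal B_1=\beta_1\beta_5-\beta_2\beta_4$, and $$\mu_1=\frac{\hat\alpha\beta_{14}-\alpha\beta_3}{\beta_3\beta_{45}+\beta_5\beta_{14}},\qquad \mu_2=\frac{\bar\alpha\beta_{25}+\alpha\beta_3}{\beta_1\beta_{25}+\beta_3\beta_{12}}.$$ -}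

module Defs where

open import Algebra.Structures using (IsCommutativeRing)
open import Algebra.Core using (Op₁; Op₂)
import Algebra.Construct.NaturalChoice.Max as Max
open import Data.Fin.Base using (Fin)
open import Data.Fin.Patterns using (0F; 1F; 2F; 3F)
import Data.Fin.Properties as Fin
open import Data.List.Base using (List; []; _∷_; map; filter; foldr)
import Data.List.Membership.DecPropositional as DecMembership
open import Data.Product.Base using (∃; _×_; _,_; proj₁)
open import Data.Product.Properties using (≡-dec)
open import Level using (Level; _⊔_; suc)
open import Relation.Binary.Bundles using (TotalOrder)
open import Relation.Binary.Construct.Closure.ReflexiveTransitive using (Star; ε; _◅_)
import Relation.Binary.Construct.StrictToNonStrict as StrictToNonStrict
open import Relation.Binary.Core using (Rel)
open import Relation.Binary.Structures using (IsStrictTotalOrder)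
open import Relation.Nullary using (¬_; Dec; yes; no)
open import Relation.Unary using (Pred; _∈_; Satisfiable)

-- The classical axioms for the real numbers, which determine ℝ up to unique
-- isomorphism. The order is decidable and suprema exist for arbitrary
-- predicates, so the intended model is ℝ of classical mathematics.
record CompleteOrderedField (c ℓ₁ ℓ₂ : Level) : Set (suc (c ⊔ ℓ₁ ⊔ ℓ₂)) where
  infix  8 -_
  infixl 7 _*_ _/_
  infixl 6 _+_ _-_
  infix  4 _≈_ _≉_ _<_
  field
    Carrier : Set c
    _≈_     : Rel Carrier ℓ₁
    _<_     : Rel Carrier ℓ₂
    _+_ _*_ : Op₂ Carrier
    -_      : Op₁ Carrier
    0# 1#   : Carrier
    isCommutativeRing  : IsCommutativeRing _≈_ _+_ _*_ -_ 0# 1#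
    isStrictTotalOrder : IsStrictTotalOrder _≈_ _<_

  _≉_ : Rel Carrier ℓ₁
  x ≉ y = ¬ (x ≈ y)

  open StrictToNonStrict _≈_ _<_ public using (_≤_)

  UpperBound : ∀ {ℓ} → Pred Carrier ℓ → Pred Carrier (c ⊔ ℓ₁ ⊔ ℓ₂ ⊔ ℓ)
  UpperBound S b = ∀ x → x ∈ S → x ≤ b

  field
    0<1      : 0# < 1#
    +-mono-< : ∀ {x y} z → x < y → z + x < z + y
    *-pos    : ∀ {x y} → 0# < x → 0# < y → 0# < x * y
    inverse  : ∀ x → x ≉ 0# → ∃ λ y → x * y ≈ 1#
    complete : (S : Pred Carrier (c ⊔ ℓ₁ ⊔ ℓ₂)) →
               Satisfiable S → Satisfiable (UpperBound S) →
               ∃ λ s → UpperBound S s × (∀ b → UpperBound S b → s ≤ b)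

  open IsStrictTotalOrder isStrictTotalOrder public using (_≟_)

  ≤-totalOrder : TotalOrder c ℓ₁ (ℓ₁ ⊔ ℓ₂)
  ≤-totalOrder = record
    { isTotalOrder = StrictToNonStrict.isTotalOrder _≈_ _<_ isStrictTotalOrder }

  max : Op₂ Carrier
  max = Max._⊔_ ≤-totalOrder

  _-_ : Op₂ Carrier
  x - y = x + (- y)

  -- Total, with the junk value 0# at 0#.
  _⁻¹ : Op₁ Carrier
  x ⁻¹ with x ≟ 0#
  ... | yes _  = 0#
  ... | no x≉0 = proj₁ (inverse x x≉0)

  _/_ : Op₂ Carrier
  x / y = x * (y ⁻¹)

Node : Set
Node = Fin 4

pattern a = 0F
pattern b = 1F
pattern c = 2F
pattern d = 3F

data Network : Set where
  N N⁺ : Network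

data Link : Network → Node → Node → Set where
  ab : ∀ {𝒩} → Link 𝒩 a b
  bd : ∀ {𝒩} → Link 𝒩 b d
  bc : Link N⁺ b c
  ac : ∀ {𝒩} → Link 𝒩 a c
  cd : ∀ {𝒩} → Link 𝒩 c d

-- All directed walks from a to d; since the links form no cycle, these are
-- exactly P₁, P₂ and, in N⁺ only, P₃.
Path : Network → Set
Path 𝒩 = Star (Link 𝒩) a d

P₁ P₂ : ∀ {𝒩} → Path 𝒩
P₁ = ab ◅ bd ◅ ε
P₂ = ac ◅ cd ◅ ε

P₃ : Path N⁺
P₃ = ab ◅ bc ◅ cd ◅ ε

paths : ∀ 𝒩 → List (Path 𝒩)
paths N  = P₁ ∷ P₂ ∷ []
paths N⁺ = P₁ ∷ P₂ ∷ P₃ ∷ []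

-- A link is determined by its end points.
linksOf : ∀ {𝒩 i j} → Star (Link 𝒩) i j → List (Node × Node)
linksOf ε                           = []
linksOf (_◅_ {i = i} {j = j} _ p) = (i , j) ∷ linksOf p

open DecMembership (≡-dec (Fin._≟_ {4}) (Fin._≟_ {4})) using () renaming (_∈_ to _∈ˡ_; _∈?_ to _∈ˡ?_)

_traverses_ : ∀ {𝒩 i j} → Star (Link 𝒩) i j → Node × Node → Set
p traverses l = l ∈ˡ linksOf p

_traverses?_ : ∀ {𝒩 i j} (p : Star (Link 𝒩) i j) l → Dec (p traverses l)
p traverses? l = l ∈ˡ? linksOf p

module Traffic {r ℓ₁ ℓ₂} (ℝ : CompleteOrderedField r ℓ₁ ℓ₂) where
  open CompleteOrderedField ℝ

  sum : List Carrier → Carrier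
  sum = foldr _+_ 0#

  record Parameters : Set (r ⊔ ℓ₁ ⊔ ℓ₂) where
    field
      α₁ α₂ α₃ α₄ α₅ : Carrier
      β₁ β₂ β₃ β₄ β₅ : Carrier
      0≤α₁ : 0# ≤ α₁
      0≤α₂ : 0# ≤ α₂
      0≤α₃ : 0# ≤ α₃
      0≤α₄ : 0# ≤ α₄
      0≤α₅ : 0# ≤ α₅
      0<β₁ : 0# < β₁
      0<β₂ : 0# < β₂
      0<β₃ : 0# < β₃
      0<β₄ : 0# < β₄
      0<β₅ : 0# < β₅

  record Flow (𝒩 : Network) (Q : Carrier) : Set (r ⊔ ℓ₁ ⊔ ℓ₂) where
    field
      amount      : Path 𝒩 → Carrier
      nonNegative : ∀ p → 0# ≤ amount p
      total       : sum (map amount (paths 𝒩)) ≈ Q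

  module _ {𝒩 : Network} {Q : Carrier} (f : Flow 𝒩 Q) where
    open Flow f

    linkFlow : Node × Node → Carrier
    linkFlow l = sum (map amount (filter (_traverses? l) (paths 𝒩)))

    Vanishing NonVanishing : Path 𝒩 → Set ℓ₁
    Vanishing    p = amount p ≈ 0#
    NonVanishing p = ¬ Vanishing p

  module _ (π : Parameters) where
    open Parameters π

    linkTime : ∀ {𝒩 i j} → Link 𝒩 i j → Carrier → Carrier
    linkTime ab x = α₁ + β₁ * x
    linkTime bd x = α₂ + β₂ * x
    linkTime bc x = α₃ + β₃ * x
    linkTime ac x = α₄ + β₄ * x
    linkTime cd x = α₅ + β₅ * x

    pathTime : ∀ {𝒩 Q i j} → Flow 𝒩 Q → Star (Link 𝒩) i j → Carrier
    pathTime f ε                           = 0#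
    pathTime f (_◅_ {i = i} {j = j} l p) = linkTime l (linkFlow f (i , j)) + pathTime f p

    -- f is an equilibrium whose common travel time is T. If Q is positive,
    -- some path has non-vanishing flow, so f determines T.
    record IsEquilibrium {𝒩 Q} (f : Flow 𝒩 Q) (T : Carrier) : Set (ℓ₁ ⊔ ℓ₂) where
      field
        nonVanishing⇒≈ : ∀ p → NonVanishing f p → pathTime f p ≈ T
        vanishing⇒≥    : ∀ p → Vanishing f p → T ≤ pathTime f p

  module Notation (π : Parameters) where
    open Parameters π public

    α₁₂ α₁₃ α₃₅ α₄₅ : Carrier
    α₁₂ = α₁ + α₂
    α₁₃ = α₁ + α₃
    α₃₅ = α₃ + α₅
    α₄₅ = α₄ + α₅

    β₁₂ β₁₄ β₂₅ β₄₅ : Carrier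
    β₁₂ = β₁ + β₂
    β₁₄ = β₁ + β₄
    β₂₅ = β₂ + β₅
    β₄₅ = β₄ + β₅

    α ᾱ α̂ ℬ₁ μ₁ μ₂ : Carrier
    α  = α₄₅ - α₁₂
    ᾱ  = α₄ - α₁₃
    α̂  = α₂ - α₃₅
    ℬ₁ = β₁ * β₅ - β₂ * β₄
    μ₁ = (α̂ * β₁₄ - α * β₃) / (β₃ * β₄₅ + β₅ * β₁₄)
    μ₂ = (ᾱ * β₂₅ + α * β₃) / (β₁ * β₂₅ + β₃ * β₁₂)

{-# OPTIONS --safe #-}

-- Put β₁₂ + β₄₅ = W and let s > 0 be the flow of P₃. Eliminating the other path
-- flows from the equilibrium equations of N and of N⁺ gives
-- (T⁺ − T) W = s ℬ₁, so the paradox occurs if and only if ℬ₁ > 0. The bounds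
-- on Q only express the positivity of the path flows: with
-- Δ = β₃ β₁₄ + β₂₅ β₁₄ + β₂₅ β₃, each flow multiplied by W (in N) or Δ (in N⁺)
-- is an affine function of Q.
module Submission where

open import Defs
open import Algebra.Bundles using (CommutativeRing)
import Algebra.Construct.NaturalChoice.Max as Max
import Algebra.Construct.NaturalChoice.MaxOp as MaxOp
import Algebra.Properties.Ring as RingProperties
import Algebra.Properties.Semiring.Mult as Mult
import Algebra.Solver.Ring as RingSolver
open import Algebra.Solver.Ring.AlmostCommutativeRing
  using (fromCommutativeRing; _-Raw-AlmostCommutative⟶_)
open import Data.Empty using (⊥-elim)
open import Data.Integer.Base as ℤ using (ℤ; +_; -[1+_]; _⊖_; _◃_; sign; ∣_∣)
import Data.Integer.Properties as ℤ
open import Data.Maybe.Base using (Maybe; map)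
open import Data.Nat.Base as ℕ using (ℕ; zero; suc)
open import Data.Product.Base using (_×_; _,_; proj₁; proj₂)
open import Data.Sign.Base as Sign using (Sign)
open import Data.Sum.Base using (inj₁; inj₂)
open import Function.Bundles using (_⇔_; mk⇔)
import Relation.Binary.PropositionalEquality.Core as ≡
import Relation.Binary.Reasoning.Setoid as SetoidReasoning
open import Relation.Binary.Definitions using (tri<; tri≈; tri>)
open import Relation.Binary.Structures using (IsStrictTotalOrder)
open import Relation.Nullary using (yes; no)
open import Relation.Nullary.Decidable.Core using (dec⇒maybe)

-- The canonical homomorphism from ℤ to a commutative ring.

-- Coefficients in ℤ rather than in R, because equality in R does not compute and
-- the solver could then not cancel terms.
module IntegerCoefficientSolver {c ℓ} (R : CommutativeRing c ℓ) where
  open CommutativeRing R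
  open Mult semiring using (×-homo-+; ×1-homo-*) renaming (_×_ to _·_)
  open RingProperties ring
    using (-‿involutive; -‿distribˡ-*; -‿distribʳ-*; -0#≈0#; -‿+-comm)
  open SetoidReasoning setoid

  fromℕ : ℕ → Carrier
  fromℕ n = n · 1#

  fromℤ : ℤ → Carrier
  fromℤ (+ n)    = fromℕ n
  fromℤ -[1+ n ] = - fromℕ (suc n)

  -- Multiplication in ℤ is defined by sign and absolute value. Carrying this decomposition over to
  -- the ring lets `fromℤ-*` treat the two factors separately.
  signed : Sign → Carrier → Carrier
  signed Sign.+ x = x
  signed Sign.- x = - x

  -- For the recursive step of `fromℤ-⊖`, where both arguments lose a successor, that is, a summand
  -- `1#`.
  x+-y-cancelˡ : ∀ z x y → (z + x) + - (z + y) ≈ x + - y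
  x+-y-cancelˡ z x y = begin
    (z + x) + - (z + y)     ≈⟨ +-congˡ (-‿+-comm z y) ⟨
    (z + x) + (- z + - y)   ≈⟨ +-congʳ (+-comm z x) ⟩
    (x + z) + (- z + - y)   ≈⟨ +-assoc x z _ ⟩
    x + (z + (- z + - y))   ≈⟨ +-congˡ (+-assoc z (- z) (- y)) ⟨
    x + ((z + - z) + - y)   ≈⟨ +-congˡ (+-congʳ (-‿inverseʳ z)) ⟩
    x + (0# + - y)          ≈⟨ +-congˡ (+-identityˡ (- y)) ⟩
    x + - y                 ∎

  fromℤ-⊖ : ∀ m n → fromℤ (m ⊖ n) ≈ fromℕ m + - fromℕ n
  fromℤ-⊖ zero    zero    = sym (-‿inverseʳ 0#)
  fromℤ-⊖ zero    (suc n) = sym (+-identityˡ _)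
  fromℤ-⊖ (suc m) zero    = sym (trans (+-congˡ -0#≈0#) (+-identityʳ _))
  fromℤ-⊖ (suc m) (suc n) = begin
    fromℤ (suc m ⊖ suc n)             ≡⟨ ≡.cong fromℤ (ℤ.[1+m]⊖[1+n]≡m⊖n m n) ⟩
    fromℤ (m ⊖ n)                     ≈⟨ fromℤ-⊖ m n ⟩
    fromℕ m + - fromℕ n               ≈⟨ x+-y-cancelˡ 1# _ _ ⟨
    fromℕ (suc m) + - fromℕ (suc n)   ∎

  fromℤ-+ : ∀ i j → fromℤ (i ℤ.+ j) ≈ fromℤ i + fromℤ j
  fromℤ-+ (+ m)    (+ n)    = ×-homo-+ 1# m n
  fromℤ-+ (+ m)    -[1+ n ] = fromℤ-⊖ m (suc n)
  fromℤ-+ -[1+ m ] (+ n)    = trans (fromℤ-⊖ n (suc m)) (+-comm _ _)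
  fromℤ-+ -[1+ m ] -[1+ n ] = begin
    fromℤ (-[1+ m ] ℤ.+ -[1+ n ])         ≡⟨ ≡.cong fromℤ (ℤ.neg-distrib-+ (+ suc m) (+ suc n)) ⟨
    - fromℕ (suc m ℕ.+ suc n)             ≈⟨ -‿cong (×-homo-+ 1# (suc m) (suc n)) ⟩
    - (fromℕ (suc m) + fromℕ (suc n))     ≈⟨ -‿+-comm _ _ ⟨
    - fromℕ (suc m) + - fromℕ (suc n)     ∎

  fromℤ-neg : ∀ i → fromℤ (ℤ.- i) ≈ - fromℤ i
  fromℤ-neg (+ zero)  = sym -0#≈0#
  fromℤ-neg (+ suc n) = refl
  fromℤ-neg -[1+ n ]  = sym (-‿involutive _)

  fromℤ-◃ : ∀ s n → fromℤ (s ◃ n) ≈ signed s (fromℕ n)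
  fromℤ-◃ Sign.+ zero    = refl
  fromℤ-◃ Sign.+ (suc n) = refl
  fromℤ-◃ Sign.- zero    = sym -0#≈0#
  fromℤ-◃ Sign.- (suc n) = refl

  signed-cong : ∀ s {x y} → x ≈ y → signed s x ≈ signed s y
  signed-cong Sign.+ x≈y = x≈y
  signed-cong Sign.- x≈y = -‿cong x≈y

  signed-* : ∀ s t x y → signed (s Sign.* t) (x * y) ≈ signed s x * signed t y
  signed-* Sign.+ Sign.+ x y = refl
  signed-* Sign.+ Sign.- x y = -‿distribʳ-* x y
  signed-* Sign.- Sign.+ x y = -‿distribˡ-* x y
  signed-* Sign.- Sign.- x y = begin
    x * y         ≈⟨ -‿involutive _ ⟨
    - - (x * y)   ≈⟨ -‿cong (-‿distribˡ-* x y) ⟩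
    - (- x * y)   ≈⟨ -‿distribʳ-* (- x) y ⟩
    - x * - y     ∎

  fromℤ-sign : ∀ i → fromℤ i ≈ signed (sign i) (fromℕ ∣ i ∣)
  fromℤ-sign (+ n)    = refl
  fromℤ-sign -[1+ n ] = refl

  fromℤ-* : ∀ i j → fromℤ (i ℤ.* j) ≈ fromℤ i * fromℤ j
  fromℤ-* i j = begin
    fromℤ (i ℤ.* j)                                                ≈⟨ fromℤ-◃ (sign i Sign.* sign j) (∣ i ∣ ℕ.* ∣ j ∣) ⟩
    signed (sign i Sign.* sign j) (fromℕ (∣ i ∣ ℕ.* ∣ j ∣))        ≈⟨ signed-cong (sign i Sign.* sign j) (×1-homo-* ∣ i ∣ ∣ j ∣) ⟩
    signed (sign i Sign.* sign j) (fromℕ ∣ i ∣ * fromℕ ∣ j ∣)      ≈⟨ signed-* (sign i) (sign j) _ _ ⟩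
    signed (sign i) (fromℕ ∣ i ∣) * signed (sign j) (fromℕ ∣ j ∣)  ≈⟨ *-cong (fromℤ-sign i) (fromℤ-sign j) ⟨
    fromℤ i * fromℤ j                                              ∎

  fromℤ-homomorphism : ℤ.+-*-rawRing -Raw-AlmostCommutative⟶ fromCommutativeRing R
  fromℤ-homomorphism = record
    { ⟦_⟧    = fromℤ
    ; +-homo = fromℤ-+
    ; *-homo = fromℤ-*
    ; -‿homo = fromℤ-neg
    ; 0-homo = refl
    -- `fromℕ 1` unfolds to `1# + 0#`.
    ; 1-homo = +-identityʳ 1#
    }

  -- A sufficient test only: distinct integers may have equal images in `R`, and the answer is then
  -- `nothing`, which is sound.
  fromℤ-≟ : ∀ i j → Maybe (fromℤ i ≈ fromℤ j)
  fromℤ-≟ i j = map (λ i≡j → reflexive (≡.cong fromℤ i≡j)) (dec⇒maybe (i ℤ.≟ j))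

  open RingSolver ℤ.+-*-rawRing (fromCommutativeRing R) fromℤ-homomorphism fromℤ-≟ public
    using (solve; _:=_; _:+_; _:*_; _:-_; :-_; con)

-- Inequalities, quotients and maxima in an ordered field.

module OrderedFieldProperties {r ℓ₁ ℓ₂} (ℝ : CompleteOrderedField r ℓ₁ ℓ₂) where
  open CompleteOrderedField ℝ

  commutativeRing : CommutativeRing r ℓ₁
  commutativeRing = record { isCommutativeRing = isCommutativeRing }

  open CommutativeRing commutativeRing public
    using (refl; sym; trans; setoid; +-cong; +-congˡ; +-congʳ; +-identityʳ
          ; *-congˡ; *-congʳ; *-comm; *-assoc; *-identityʳ; -‿cong)
  open IsStrictTotalOrder isStrictTotalOrder public
    using (compare; irrefl; asym; <-respʳ-≈; <-respˡ-≈)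
    renaming (trans to <-trans)
  open IntegerCoefficientSolver commutativeRing public
  open SetoidReasoning setoid

  <-resp₂ : ∀ {x x′ y y′} → x ≈ x′ → y ≈ y′ → x < y → x′ < y′
  <-resp₂ x≈ y≈ x<y = <-respˡ-≈ x≈ (<-respʳ-≈ y≈ x<y)

  ≤∧≉⇒< : ∀ {x} → 0# ≤ x → x ≉ 0# → 0# < x
  ≤∧≉⇒< (inj₁ 0<x) _   = 0<x
  ≤∧≉⇒< (inj₂ 0≈x) x≉0 = ⊥-elim (x≉0 (sym 0≈x))

  x<x+y : ∀ x {y} → 0# < y → x < x + y
  x<x+y x 0<y = <-respˡ-≈ (+-identityʳ x) (+-mono-< x 0<y)

  x<x+y⇒0<y : ∀ x {y} → x < x + y → 0# < y
  x<x+y⇒0<y x {y} x<x+y = <-resp₂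
    (solve 1 (λ x → :- x :+ x := con (+ 0)) refl x)
    (solve 2 (λ x y → :- x :+ (x :+ y) := y) refl x y)
    (+-mono-< (- x) x<x+y)

  +-pos : ∀ {x y} → 0# < x → 0# < y → 0# < x + y
  +-pos {x} 0<x 0<y = <-trans 0<x (x<x+y x 0<y)

  -- The order axiom for products speaks of positive factors, so `y * z` is written as `x * z` plus
  -- the positive product `(- x + y) * z`.
  *-monoˡ-< : ∀ {x y z} → 0# < z → x < y → x * z < y * z
  *-monoˡ-< {x} {y} {z} 0<z x<y = <-respʳ-≈
    (solve 3 (λ x y z → x :* z :+ (:- x :+ y) :* z := y :* z) refl x y z)
    (x<x+y (x * z) (*-pos 0<y-x 0<z))
    where
    0<y-x : 0# < - x + y
    0<y-x = <-respˡ-≈ (solve 1 (λ x → :- x :+ x := con (+ 0)) refl x) (+-mono-< (- x) x<y)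

  *-cancelʳ-< : ∀ {x y z} → 0# < z → x * z < y * z → x < y
  *-cancelʳ-< {x} {y} 0<z xz<yz with compare x y
  ... | tri< x<y _ _ = x<y
  ... | tri≈ _ x≈y _ = ⊥-elim (irrefl (*-congʳ x≈y) xz<yz)
  ... | tri> _ _ y<x = ⊥-elim (asym xz<yz (*-monoˡ-< 0<z y<x))

  x*y-pos⇒y-pos : ∀ {x y} → 0# < x → 0# < x * y → 0# < y
  x*y-pos⇒y-pos {x} {y} 0<x 0<xy =
    *-cancelʳ-< 0<x (<-resp₂ (solve 1 (λ x → con (+ 0) := con (+ 0) :* x) refl x) (*-comm x y) 0<xy)

  x/y*y≈x : ∀ x {y} → 0# < y → x / y * y ≈ x
  -- The same test as in the definition of `_⁻¹`, so that the quotient reduces; `0 < y` rules out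
  -- the junk value.
  x/y*y≈x x {y} 0<y with y ≟ 0#
  ... | yes y≈0 = ⊥-elim (irrefl (sym y≈0) 0<y)
  ... | no  y≉0 = begin
    x * y⁻¹ * y    ≈⟨ *-assoc x y⁻¹ y ⟩
    x * (y⁻¹ * y)  ≈⟨ *-congˡ (trans (*-comm y⁻¹ y) (proj₂ (inverse y y≉0))) ⟩
    x * 1#         ≈⟨ *-identityʳ x ⟩
    x              ∎
    where
    y⁻¹ : Carrier
    y⁻¹ = proj₁ (inverse y y≉0)

  -- Turns an identity with positive slack `k` into a lower bound. In the applications `x` is `Q`
  -- and `k` is a path flow times a determinant.
  n+k≈x*m⇒n/m<x : ∀ {n k x m} → 0# < m → 0# < k → n + k ≈ x * m → n / m < x
  n+k≈x*m⇒n/m<x {n} 0<m 0<k n+k≈xm =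
    *-cancelʳ-< 0<m (<-resp₂ (sym (x/y*y≈x n 0<m)) n+k≈xm (x<x+y n 0<k))

  x*m+k≈n⇒x<n/m : ∀ {n k x m} → 0# < m → 0# < k → x * m + k ≈ n → x < n / m
  x*m+k≈n⇒x<n/m {n} {x = x} {m} 0<m 0<k xm+k≈n =
    *-cancelʳ-< 0<m (<-respʳ-≈ (trans xm+k≈n (sym (x/y*y≈x n 0<m))) (x<x+y (x * m) 0<k))

  -- A maximum equals one of its two arguments, so strict bounds pass to it.
  max-lub-< : ∀ x y {z} → x < z → y < z → max x y < z
  max-lub-< x y x<z y<z with MaxOp.⊔-sel (Max.maxOperator ≤-totalOrder) x y
  ... | inj₁ max≈x = <-respˡ-≈ (sym max≈x) x<z
  ... | inj₂ max≈y = <-respˡ-≈ (sym max≈y) y<z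

  -- Reduces a consequence of an equation l ≈ l′ to a ring identity.
  ≈-modulo : ∀ {l l′ x y} → l ≈ l′ → x ≈ y + (l - l′) → x ≈ y
  ≈-modulo {l} {l′} {x} {y} l≈l′ x≈ = begin
    x              ≈⟨ x≈ ⟩
    y + (l - l′)   ≈⟨ +-congˡ (+-congʳ l≈l′) ⟩
    y + (l′ - l′)  ≈⟨ solve 2 (λ y l → y :+ (l :- l) := y) refl y l′ ⟩
    y              ∎

-- Determinants and positive combinations of the link coefficients.

module TrafficProperties {r ℓ₁ ℓ₂} (ℝ : CompleteOrderedField r ℓ₁ ℓ₂)
                         (π : Traffic.Parameters ℝ) where
  open CompleteOrderedField ℝ
  open OrderedFieldProperties ℝ
  open Traffic ℝ
  open Notation π

  -- The determinants of the linear systems that determine the path flows at these equilibria: `W`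
  -- for `N`, `Δ` for `N⁺`.
  W Δ : Carrier
  W = β₁₂ + β₄₅
  Δ = β₃ * β₁₄ + β₂₅ * β₁₄ + β₂₅ * β₃

  0<β₁₂ : 0# < β₁₂
  0<β₁₂ = +-pos 0<β₁ 0<β₂

  0<β₁₄ : 0# < β₁₄
  0<β₁₄ = +-pos 0<β₁ 0<β₄

  0<β₂₅ : 0# < β₂₅
  0<β₂₅ = +-pos 0<β₂ 0<β₅

  0<β₄₅ : 0# < β₄₅
  0<β₄₅ = +-pos 0<β₄ 0<β₅

  0<W : 0# < W
  0<W = +-pos 0<β₁₂ 0<β₄₅

  0<Δ : 0# < Δ
  0<Δ = +-pos (+-pos (*-pos 0<β₃ 0<β₁₄) (*-pos 0<β₂₅ 0<β₁₄)) (*-pos 0<β₂₅ 0<β₃)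

  amount-pos : ∀ {𝒩 Q} (f : Flow 𝒩 Q) p → NonVanishing f p → 0# < Flow.amount f p
  amount-pos f p = ≤∧≉⇒< (Flow.nonNegative f p)

  -- Equilibrium of `N` with both path flows positive.

  module _ {Q T : Carrier} (f : Flow N Q) (eq : IsEquilibrium π f T)
           (nv : ∀ p → NonVanishing f p) where
    open Flow f
    open IsEquilibrium eq

    private
      x y : Carrier
      x = amount P₁
      y = amount P₂

      Q≈ : Q ≈ x + y
      Q≈ = trans (sym total) (+-congˡ (+-identityʳ y))

      T≈T₁ : T ≈ α₁₂ + β₁₂ * x
      -- Filtering the explicit list of paths computes, so `pathTime` unfolds to a polynomial in the
      -- path flows with trailing zeros, which the solver removes.
      T≈T₁ = trans (sym (nonVanishing⇒≈ P₁ (nv P₁)))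
        (solve 5 (λ α₁ α₂ β₁ β₂ x →
            α₁ :+ β₁ :* (x :+ con (+ 0)) :+ (α₂ :+ β₂ :* (x :+ con (+ 0)) :+ con (+ 0))
            := (α₁ :+ α₂) :+ (β₁ :+ β₂) :* x)
          refl α₁ α₂ β₁ β₂ x)

      T≈T₂ : T ≈ α₄₅ + β₄₅ * y
      T≈T₂ = trans (sym (nonVanishing⇒≈ P₂ (nv P₂)))
        (solve 5 (λ α₄ α₅ β₄ β₅ y →
            α₄ :+ β₄ :* (y :+ con (+ 0)) :+ (α₅ :+ β₅ :* (y :+ con (+ 0)) :+ con (+ 0))
            := (α₄ :+ α₅) :+ (β₄ :+ β₅) :* y)
          refl α₄ α₅ β₄ β₅ y)

      α≈ : α ≈ β₁₂ * x - β₄₅ * y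
      α≈ = ≈-modulo (trans (sym T≈T₂) T≈T₁)
        (solve 6 (λ α₁₂ α₄₅ β₁₂ β₄₅ x y →
            α₄₅ :- α₁₂ := (β₁₂ :* x :- β₄₅ :* y)
              :+ ((α₄₅ :+ β₄₅ :* y) :- (α₁₂ :+ β₁₂ :* x)))
          refl α₁₂ α₄₅ β₁₂ β₄₅ x y)

    -- Weighting the time of `P₂` by `β₁₂` and that of `P₁` by `β₄₅` gives both flows the
    -- coefficient `β₁₂ * β₄₅`, so only their sum `Q` remains.
    T*W≈ : T * W ≈ α₁₂ * β₄₅ + α₄₅ * β₁₂ + β₁₂ * β₄₅ * Q
    T*W≈ = begin
      T * W
        ≈⟨ solve 3 (λ T u v → T :* (u :+ v) := T :* u :+ T :* v) refl T β₁₂ β₄₅ ⟩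
      T * β₁₂ + T * β₄₅
        ≈⟨ +-cong (*-congʳ T≈T₂) (*-congʳ T≈T₁) ⟩
      (α₄₅ + β₄₅ * y) * β₁₂ + (α₁₂ + β₁₂ * x) * β₄₅
        ≈⟨ solve 6 (λ α₁₂ α₄₅ β₁₂ β₄₅ x y →
             (α₄₅ :+ β₄₅ :* y) :* β₁₂ :+ (α₁₂ :+ β₁₂ :* x) :* β₄₅
             := α₁₂ :* β₄₅ :+ α₄₅ :* β₁₂ :+ β₁₂ :* β₄₅ :* (x :+ y))
             refl α₁₂ α₄₅ β₁₂ β₄₅ x y ⟩
      α₁₂ * β₄₅ + α₄₅ * β₁₂ + β₁₂ * β₄₅ * (x + y)
        ≈⟨ +-congˡ (*-congˡ Q≈) ⟨
      α₁₂ * β₄₅ + α₄₅ * β₁₂ + β₁₂ * β₄₅ * Q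
        ∎
      where open SetoidReasoning setoid

    -- Cramer's rule for the flow of `P₂`: `y * W` is `Q * β₁₂ - α`, and it is positive.
    α/β₁₂<Q : α / β₁₂ < Q
    α/β₁₂<Q = n+k≈x*m⇒n/m<x 0<β₁₂ (*-pos (amount-pos f P₂ (nv P₂)) 0<W) (begin
      α + y * W
        ≈⟨ +-congʳ α≈ ⟩
      (β₁₂ * x - β₄₅ * y) + y * W
        ≈⟨ solve 4 (λ β₁₂ β₄₅ x y →
             (β₁₂ :* x :- β₄₅ :* y) :+ y :* (β₁₂ :+ β₄₅) := (x :+ y) :* β₁₂)
             refl β₁₂ β₄₅ x y ⟩
      (x + y) * β₁₂
        ≈⟨ *-congʳ Q≈ ⟨
      Q * β₁₂
        ∎)
      where open SetoidReasoning setoid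

    -- Likewise for `P₁`: `x * W` is `Q * β₄₅ + α`.
    -α/β₄₅<Q : - α / β₄₅ < Q
    -α/β₄₅<Q = n+k≈x*m⇒n/m<x 0<β₄₅ (*-pos (amount-pos f P₁ (nv P₁)) 0<W) (begin
      - α + x * W
        ≈⟨ +-congʳ (-‿cong α≈) ⟩
      - (β₁₂ * x - β₄₅ * y) + x * W
        ≈⟨ solve 4 (λ β₁₂ β₄₅ x y →
             :- (β₁₂ :* x :- β₄₅ :* y) :+ x :* (β₁₂ :+ β₄₅) := (x :+ y) :* β₄₅)
             refl β₁₂ β₄₅ x y ⟩
      (x + y) * β₄₅
        ≈⟨ *-congʳ Q≈ ⟨
      Q * β₄₅
        ∎)
      where open SetoidReasoning setoid

  -- Equilibrium of `N⁺` with all three path flows positive.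

  module _ {Q T⁺ : Carrier} (f : Flow N⁺ Q) (eq : IsEquilibrium π f T⁺)
           (nv : ∀ p → NonVanishing f p) where
    open Flow f
    open IsEquilibrium eq

    private
      p q s : Carrier
      p = amount P₁
      q = amount P₂
      s = amount P₃

      Q≈ : Q ≈ p + q + s
      Q≈ = trans (sym total)
        (solve 3 (λ p q s → p :+ (q :+ (s :+ con (+ 0))) := p :+ q :+ s) refl p q s)

      T⁺≈T₁ : T⁺ ≈ α₁₂ + (β₁ * (p + s) + β₂ * p)
      T⁺≈T₁ = trans (sym (nonVanishing⇒≈ P₁ (nv P₁)))
        (solve 6 (λ α₁ α₂ β₁ β₂ p s →
            α₁ :+ β₁ :* (p :+ (s :+ con (+ 0))) :+ (α₂ :+ β₂ :* (p :+ con (+ 0)) :+ con (+ 0))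
            := (α₁ :+ α₂) :+ (β₁ :* (p :+ s) :+ β₂ :* p))
          refl α₁ α₂ β₁ β₂ p s)

      T⁺≈T₂ : T⁺ ≈ α₄₅ + (β₄ * q + β₅ * (q + s))
      T⁺≈T₂ = trans (sym (nonVanishing⇒≈ P₂ (nv P₂)))
        (solve 6 (λ α₄ α₅ β₄ β₅ q s →
            α₄ :+ β₄ :* (q :+ con (+ 0)) :+ (α₅ :+ β₅ :* (q :+ (s :+ con (+ 0))) :+ con (+ 0))
            := (α₄ :+ α₅) :+ (β₄ :* q :+ β₅ :* (q :+ s)))
          refl α₄ α₅ β₄ β₅ q s)

      T⁺≈T₃ : T⁺ ≈ α₁ + α₃₅ + (β₁ * (p + s) + β₃ * s + β₅ * (q + s))
      T⁺≈T₃ = trans (sym (nonVanishing⇒≈ P₃ (nv P₃)))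
        (solve 9 (λ α₁ α₃ α₅ β₁ β₃ β₅ p q s →
            α₁ :+ β₁ :* (p :+ (s :+ con (+ 0))) :+ (α₃ :+ β₃ :* (s :+ con (+ 0))
              :+ (α₅ :+ β₅ :* (q :+ (s :+ con (+ 0))) :+ con (+ 0)))
            := α₁ :+ (α₃ :+ α₅) :+ (β₁ :* (p :+ s) :+ β₃ :* s :+ β₅ :* (q :+ s)))
          refl α₁ α₃ α₅ β₁ β₃ β₅ p q s)

      α≈ : α ≈ (β₁ * (p + s) + β₂ * p) - (β₄ * q + β₅ * (q + s))
      α≈ = ≈-modulo (trans (sym T⁺≈T₂) T⁺≈T₁)
        (solve 4 (λ α₁₂ α₄₅ u v →
            α₄₅ :- α₁₂ := (u :- v) :+ ((α₄₅ :+ v) :- (α₁₂ :+ u)))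
          refl α₁₂ α₄₅ _ _)

      -- Comparing `P₁` with `P₃` cancels the time on their common link from `a` to `b`.
      α̂≈ : α̂ ≈ β₃ * s + β₅ * (q + s) - β₂ * p
      α̂≈ = ≈-modulo (trans (sym T⁺≈T₁) T⁺≈T₃)
        (solve 7 (λ α₁ α₂ α₃₅ u v w z →
            α₂ :- α₃₅ := (v :+ w :- z)
              :+ ((α₁ :+ α₂ :+ (u :+ z)) :- (α₁ :+ α₃₅ :+ (u :+ v :+ w))))
          refl α₁ α₂ α₃₅ _ _ _ _)

      -- Comparing `P₂` with `P₃` cancels the time on their common link from `c` to `d`.
      ᾱ≈ : ᾱ ≈ β₁ * (p + s) + β₃ * s - β₄ * q
      ᾱ≈ = ≈-modulo (trans (sym T⁺≈T₂) T⁺≈T₃)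
        (solve 8 (λ α₁ α₃ α₄ α₅ u v w z →
            α₄ :- (α₁ :+ α₃) := (u :+ v :- z)
              :+ ((α₄ :+ α₅ :+ (z :+ w)) :- (α₁ :+ (α₃ :+ α₅) :+ (u :+ v :+ w))))
          refl α₁ α₃ α₄ α₅ _ _ _ _)

    -- The same weights as in `T*W≈`. The flow `s` now has coefficient `β₅ * β₁₂ + β₁ * β₄₅`, which
    -- exceeds `β₁₂ * β₄₅` by exactly `ℬ₁`.
    T⁺*W≈ : T⁺ * W ≈ α₁₂ * β₄₅ + α₄₅ * β₁₂ + β₁₂ * β₄₅ * Q + s * ℬ₁
    T⁺*W≈ = begin
      T⁺ * W
        ≈⟨ solve 3 (λ T u v → T :* (u :+ v) := T :* u :+ T :* v) refl T⁺ β₁₂ β₄₅ ⟩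
      T⁺ * β₁₂ + T⁺ * β₄₅
        ≈⟨ +-cong (*-congʳ T⁺≈T₂) (*-congʳ T⁺≈T₁) ⟩
      (α₄₅ + (β₄ * q + β₅ * (q + s))) * β₁₂ + (α₁₂ + (β₁ * (p + s) + β₂ * p)) * β₄₅
        ≈⟨ solve 9 (λ α₁₂ α₄₅ β₁ β₂ β₄ β₅ p q s →
             (α₄₅ :+ (β₄ :* q :+ β₅ :* (q :+ s))) :* (β₁ :+ β₂)
               :+ (α₁₂ :+ (β₁ :* (p :+ s) :+ β₂ :* p)) :* (β₄ :+ β₅)
             := α₁₂ :* (β₄ :+ β₅) :+ α₄₅ :* (β₁ :+ β₂)
               :+ (β₁ :+ β₂) :* (β₄ :+ β₅) :* (p :+ q :+ s)
               :+ s :* (β₁ :* β₅ :- β₂ :* β₄))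
             refl α₁₂ α₄₅ β₁ β₂ β₄ β₅ p q s ⟩
      α₁₂ * β₄₅ + α₄₅ * β₁₂ + β₁₂ * β₄₅ * (p + q + s) + s * ℬ₁
        ≈⟨ +-congʳ (+-congˡ (*-congˡ Q≈)) ⟨
      α₁₂ * β₄₅ + α₄₅ * β₁₂ + β₁₂ * β₄₅ * Q + s * ℬ₁
        ∎
      where open SetoidReasoning setoid

    -- Cramer's rule for `P₁`: `p * Δ` is `Q` times the denominator of `μ₁` minus its numerator.
    μ₁<Q : μ₁ < Q
    μ₁<Q = n+k≈x*m⇒n/m<x (+-pos (*-pos 0<β₃ 0<β₄₅) (*-pos 0<β₅ 0<β₁₄))
      (*-pos (amount-pos f P₁ (nv P₁)) 0<Δ) (begin
      (α̂ * β₁₄ - α * β₃) + p * Δ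
        ≈⟨ +-congʳ (+-cong (*-congʳ α̂≈) (-‿cong (*-congʳ α≈))) ⟩
      _
        ≈⟨ solve 8 (λ β₁ β₂ β₃ β₄ β₅ p q s →
             ((β₃ :* s :+ β₅ :* (q :+ s) :- β₂ :* p) :* (β₁ :+ β₄)
               :- ((β₁ :* (p :+ s) :+ β₂ :* p) :- (β₄ :* q :+ β₅ :* (q :+ s))) :* β₃)
               :+ p :* (β₃ :* (β₁ :+ β₄) :+ (β₂ :+ β₅) :* (β₁ :+ β₄) :+ (β₂ :+ β₅) :* β₃)
             := (p :+ q :+ s) :* (β₃ :* (β₄ :+ β₅) :+ β₅ :* (β₁ :+ β₄)))
             refl β₁ β₂ β₃ β₄ β₅ p q s ⟩
      (p + q + s) * (β₃ * β₄₅ + β₅ * β₁₄)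
        ≈⟨ *-congʳ Q≈ ⟨
      Q * (β₃ * β₄₅ + β₅ * β₁₄)
        ∎)
      where open SetoidReasoning setoid

    -- The same for `P₂`, with `q * Δ` and the numerator and denominator of `μ₂`.
    μ₂<Q : μ₂ < Q
    μ₂<Q = n+k≈x*m⇒n/m<x (+-pos (*-pos 0<β₁ 0<β₂₅) (*-pos 0<β₃ 0<β₁₂))
      (*-pos (amount-pos f P₂ (nv P₂)) 0<Δ) (begin
      (ᾱ * β₂₅ + α * β₃) + q * Δ
        ≈⟨ +-congʳ (+-cong (*-congʳ ᾱ≈) (*-congʳ α≈)) ⟩
      _
        ≈⟨ solve 8 (λ β₁ β₂ β₃ β₄ β₅ p q s →
             ((β₁ :* (p :+ s) :+ β₃ :* s :- β₄ :* q) :* (β₂ :+ β₅)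
               :+ ((β₁ :* (p :+ s) :+ β₂ :* p) :- (β₄ :* q :+ β₅ :* (q :+ s))) :* β₃)
               :+ q :* (β₃ :* (β₁ :+ β₄) :+ (β₂ :+ β₅) :* (β₁ :+ β₄) :+ (β₂ :+ β₅) :* β₃)
             := (p :+ q :+ s) :* (β₁ :* (β₂ :+ β₅) :+ β₃ :* (β₁ :+ β₂)))
             refl β₁ β₂ β₃ β₄ β₅ p q s ⟩
      (p + q + s) * (β₁ * β₂₅ + β₃ * β₁₂)
        ≈⟨ *-congʳ Q≈ ⟨
      Q * (β₁ * β₂₅ + β₃ * β₁₂)
        ∎)
      where open SetoidReasoning setoid

    -- Cramer's rule for `P₃`: in `s * Δ` the coefficient of `Q` is `- ℬ₁`, so for positive `ℬ₁` a
    -- positive flow bounds `Q` from above.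
    Q<[α̂β₁₄+ᾱβ₂₅]/ℬ₁ : 0# < ℬ₁ → Q < (α̂ * β₁₄ + ᾱ * β₂₅) / ℬ₁
    Q<[α̂β₁₄+ᾱβ₂₅]/ℬ₁ 0<ℬ₁ = x*m+k≈n⇒x<n/m 0<ℬ₁ (*-pos (amount-pos f P₃ (nv P₃)) 0<Δ) (begin
      Q * ℬ₁ + s * Δ
        ≈⟨ +-congʳ (*-congʳ Q≈) ⟩
      (p + q + s) * ℬ₁ + s * Δ
        ≈⟨ solve 8 (λ β₁ β₂ β₃ β₄ β₅ p q s →
             (p :+ q :+ s) :* (β₁ :* β₅ :- β₂ :* β₄)
               :+ s :* (β₃ :* (β₁ :+ β₄) :+ (β₂ :+ β₅) :* (β₁ :+ β₄) :+ (β₂ :+ β₅) :* β₃)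
             := (β₃ :* s :+ β₅ :* (q :+ s) :- β₂ :* p) :* (β₁ :+ β₄)
               :+ (β₁ :* (p :+ s) :+ β₃ :* s :- β₄ :* q) :* (β₂ :+ β₅))
             refl β₁ β₂ β₃ β₄ β₅ p q s ⟩
      _
        ≈⟨ +-cong (*-congʳ α̂≈) (*-congʳ ᾱ≈) ⟨
      α̂ * β₁₄ + ᾱ * β₂₅
        ∎)
      where open SetoidReasoning setoid

  -- Comparison of the two equilibria at the same total flow.

  module _ {Q T T⁺ : Carrier}
           (f : Flow N Q) (eq : IsEquilibrium π f T) (nv : ∀ p → NonVanishing f p)
           (f⁺ : Flow N⁺ Q) (eq⁺ : IsEquilibrium π f⁺ T⁺) (nv⁺ : ∀ p → NonVanishing f⁺ p) where

    private
      s : Carrier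
      s = Flow.amount f⁺ P₃

      0<s : 0# < s
      0<s = amount-pos f⁺ P₃ (nv⁺ P₃)

      T⁺*W≈T*W+s*ℬ₁ : T⁺ * W ≈ T * W + s * ℬ₁
      T⁺*W≈T*W+s*ℬ₁ = trans (T⁺*W≈ f⁺ eq⁺ nv⁺) (+-congʳ (sym (T*W≈ f eq nv)))

    T<T⁺⇒0<ℬ₁ : T < T⁺ → 0# < ℬ₁
    T<T⁺⇒0<ℬ₁ T<T⁺ = x*y-pos⇒y-pos 0<s
      (x<x+y⇒0<y (T * W) (<-respʳ-≈ T⁺*W≈T*W+s*ℬ₁ (*-monoˡ-< 0<W T<T⁺)))

    0<ℬ₁⇒T<T⁺ : 0# < ℬ₁ → T < T⁺
    0<ℬ₁⇒T<T⁺ 0<ℬ₁ = *-cancelʳ-< 0<W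
      (<-respʳ-≈ (sym T⁺*W≈T*W+s*ℬ₁) (x<x+y (T * W) (*-pos 0<s 0<ℬ₁)))

    -- The four entries express, in this order, the positivity of the flows of `P₂` and `P₁` in `N`
    -- and of `P₁` and `P₂` in `N⁺`.
    max<Q : max (max (α / β₁₂) (- α / β₄₅)) (max μ₁ μ₂) < Q
    max<Q = max-lub-< (max (α / β₁₂) (- α / β₄₅)) (max μ₁ μ₂)
      (max-lub-< (α / β₁₂) (- α / β₄₅) (α/β₁₂<Q f eq nv) (-α/β₄₅<Q f eq nv))
      (max-lub-< μ₁ μ₂ (μ₁<Q f⁺ eq⁺ nv⁺) (μ₂<Q f⁺ eq⁺ nv⁺))

    T<T⁺⇒bounds : T < T⁺ →
      (0# < ℬ₁) ×
      (max (max (α / β₁₂) (- α / β₄₅)) (max μ₁ μ₂) < Q) ×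
      (Q < (α̂ * β₁₄ + ᾱ * β₂₅) / ℬ₁)
    -- The sign of `ℬ₁` is settled first, since the upper bound divides by it.
    T<T⁺⇒bounds T<T⁺ = 0<ℬ₁ , max<Q , Q<[α̂β₁₄+ᾱβ₂₅]/ℬ₁ f⁺ eq⁺ nv⁺ 0<ℬ₁
      where
      0<ℬ₁ : 0# < ℬ₁
      0<ℬ₁ = T<T⁺⇒0<ℬ₁ T<T⁺

theorem1 : ∀ {r ℓ₁ ℓ₂} (ℝ : CompleteOrderedField r ℓ₁ ℓ₂) →
    let open CompleteOrderedField ℝ
        open Traffic ℝ in
    (π : Parameters) (Q : Carrier) → 0# < Q →
    let open Notation π in
    (f : Flow N Q) (T : Carrier) → IsEquilibrium π f T →
    (f⁺ : Flow N⁺ Q) (T⁺ : Carrier) → IsEquilibrium π f⁺ T⁺ →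
    (∀ p → NonVanishing f p) → (∀ p → NonVanishing f⁺ p) →
    (T < T⁺) ⇔
    ((0# < ℬ₁) ×
     (max (max (α / β₁₂) (- α / β₄₅)) (max μ₁ μ₂) < Q) ×
     (Q < (α̂ * β₁₄ + ᾱ * β₂₅) / ℬ₁))
theorem1 ℝ π Q _ f T eq f⁺ T⁺ eq⁺ nv nv⁺ = mk⇔
  (T<T⁺⇒bounds f eq nv f⁺ eq⁺ nv⁺)
  (λ bounds → 0<ℬ₁⇒T<T⁺ f eq nv f⁺ eq⁺ nv⁺ (proj₁ bounds))
  where
  open TrafficProperties ℝ π
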